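{- For every integer $p\ge 1$, $$\sum_{j=1}^{p}{p+1\brace p-j}\frac{H_{j}}{j!}=\frac{p!-(p+1)p^{p}+p^{p+1}H_{p}}{p!}.$$
   Context: ${n\brace k}$ denotes the Stirling number of the second kind, i.e. $\sum_{n\ge 0}{n\brace k}\frac{t^n}{n!}=\frac{(e^t-1)^k}{k!}$ (in particular ${n\brace 0}=0$ for $n\ge 1$). $H_n=\sum_{j=1}^{n}\frac1j$ is the $n$th harmonic number. -}

module Defs where

open import Data.Fin.Base using (toℕ)
open import Data.Integer.Base using (+_)
open import Data.Nat.Base as ℕ using (ℕ; zero; suc; _∸_; _!)
open import Data.Nat.Properties using (_!≢0)
open import Data.Rational.Base using (ℚ; 0ℚ; 1ℚ; _-_; _*_; _÷_; _/_; NonZero)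
open import Data.Rational.Properties using (+-0-commutativeMonoid; normalize-pos; pos⇒nonZero)

open import Algebra.Properties.CommutativeMonoid.Sum +-0-commutativeMonoid public
  using (sum-syntax; sum⁺-syntax)

fromℕ : ℕ → ℚ
fromℕ n = + n / 1

fromℕ-nonZero : ∀ n → .{{ℕ.NonZero n}} → NonZero (fromℕ n)
fromℕ-nonZero n = pos⇒nonZero (fromℕ n) {{normalize-pos n 1}}

infixl 7 _/!_

_/!_ : ℚ → ℕ → ℚ
x /! n = (x ÷ fromℕ (n !)) {{fromℕ-nonZero (n !) {{n !≢0}}}}

harmonic : ℕ → ℚ
harmonic n = ∑[ i < n ] (+ 1 / suc (toℕ i))

-- The series a stands for the formal power series Σₙ a n · tⁿ (the
-- coefficients are ordinary, not exponential).
PowerSeries : Set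
PowerSeries = ℕ → ℚ

infixl 6 _⊖_
infixl 7 _⊛_
infixr 8 _^ˢ_

1ˢ : PowerSeries
1ˢ zero    = 1ℚ
1ˢ (suc _) = 0ℚ

_⊖_ : PowerSeries → PowerSeries → PowerSeries
(a ⊖ b) n = a n - b n

-- Cauchy product; ∑[ i ≤ n ] runs over 0, …, n.
_⊛_ : PowerSeries → PowerSeries → PowerSeries
(a ⊛ b) n = ∑[ i ≤ n ] (a (toℕ i) * b (n ∸ toℕ i))

_^ˢ_ : PowerSeries → ℕ → PowerSeries
a ^ˢ zero  = 1ˢ
a ^ˢ suc k = a ⊛ (a ^ˢ k)

expˢ : PowerSeries
expˢ n = 1ℚ /! n

-- Stirling numbers of the second kind, as n! times the coefficient of tⁿ
-- in (eᵗ - 1)ᵏ / k!.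
stirling₂ : ℕ → ℕ → ℚ
stirling₂ n k = fromℕ (n !) * (((expˢ ⊖ 1ˢ) ^ˢ k) n /! k)

{-# OPTIONS --safe #-}
-- Read xⁿ = Σₖ S(n,k) x(x-1)⋯(x-k+1) together with its derivative
-- n xⁿ⁻¹ = Σₖ S(n,k) (x(x-1)⋯(x-k+1))′ at n = p + 1, x = p, and divide by p!.
-- For k ≤ p the falling factorial becomes 1/(p-k)! and its derivative
-- (H_p - H_{p-k})/(p-k)!; for k = p + 1 they become 0 and 1. Eliminating the
-- terms H_p/(p-k)! between the two identities leaves the claim. The
-- recurrence for S(n,k) behind the first identity comes from E′ = E + 1 for
-- E = eᵗ - 1, which gives (Eᵏ⁺¹)′ = (k + 1)(Eᵏ⁺¹ + Eᵏ).
module Submission where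

open import Defs
open import Algebra.Bundles using (module CommutativeRing)
import Algebra.Properties.Semiring.Sum as SemiringSum
open import Data.Fin.Base using (Fin; toℕ; zero; suc; opposite)
import Data.Fin.Permutation as Perm
open import Data.Fin.Properties
  using (toℕ-fromℕ; toℕ-inject₁; toℕ<n; toℕ≤pred[n]; opposite-prop)
import Data.Integer.Base as ℤ
import Data.Integer.Properties as ℤₚ
open import Data.Nat.Base as ℕ using (ℕ; zero; suc; _∸_; _^_; _≥_; _!)
import Data.Nat.Properties as ℕₚ
open import Data.Nat.Tactic.RingSolver using () renaming (solve-∀ to ℕ-solve-∀)
open import Data.Rational.Base
  using (ℚ; 0ℚ; 1ℚ; _+_; _-_; _*_; _/_; fromℚᵘ; toℚᵘ)
open import Data.Rational.Properties
open import Data.Rational.Solver using (module +-*-Solver)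
open import Data.Rational.Unnormalised.Base as ℚᵘ using (ℚᵘ; mkℚᵘ; *≡*)
import Data.Rational.Unnormalised.Properties as ℚᵘₚ
open import Function.Base using (_∘_)
open import Relation.Binary.PropositionalEquality
  using (_≡_; _≗_; refl; sym; trans; cong; cong₂; module ≡-Reasoning)

open SemiringSum (CommutativeRing.semiring +-*-commutativeRing)
  using (sum-cong-≗; sum-init-last; ∑-distrib-+; ∑-permute; *-distribˡ-sum; *-distribʳ-sum)
open +-*-Solver using (solve; con; _:=_; _:+_; _:*_; _:-_)
open ≡-Reasoning

-- Embedding of the naturals in the rationals

fromℚᵘ-homo-* : ∀ p q → fromℚᵘ (p ℚᵘ.* q) ≡ fromℚᵘ p * fromℚᵘ q
fromℚᵘ-homo-* p q = toℚᵘ-injective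
  (ℚᵘₚ.≃-trans (toℚᵘ-fromℚᵘ (p ℚᵘ.* q))
  (ℚᵘₚ.≃-sym (ℚᵘₚ.≃-trans (toℚᵘ-homo-* (fromℚᵘ p) (fromℚᵘ q))
    (ℚᵘₚ.*-cong (toℚᵘ-fromℚᵘ p) (toℚᵘ-fromℚᵘ q)))))

fromℚᵘ-homo-+ : ∀ p q → fromℚᵘ (p ℚᵘ.+ q) ≡ fromℚᵘ p + fromℚᵘ q
fromℚᵘ-homo-+ p q = toℚᵘ-injective
  (ℚᵘₚ.≃-trans (toℚᵘ-fromℚᵘ (p ℚᵘ.+ q))
  (ℚᵘₚ.≃-sym (ℚᵘₚ.≃-trans (toℚᵘ-homo-+ (fromℚᵘ p) (fromℚᵘ q))
    (ℚᵘₚ.+-cong (toℚᵘ-fromℚᵘ p) (toℚᵘ-fromℚᵘ q)))))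

-- Unnormalised representative: `fromℚᵘ (integral n)` reduces to `fromℕ n`, so identities can be
-- checked by cross-multiplication before any common divisor is removed.
integral : ℕ → ℚᵘ
integral n = mkℚᵘ (ℤ.+ n) 0

fromℕ-homo-+ : ∀ m n → fromℕ (m ℕ.+ n) ≡ fromℕ m + fromℕ n
fromℕ-homo-+ m n = trans
  (fromℚᵘ-cong {integral (m ℕ.+ n)} {integral m ℚᵘ.+ integral n}
    (*≡* (cong (ℤ._* ℤ.+ 1)
      (cong₂ ℤ._+_ (sym (ℤₚ.*-identityʳ (ℤ.+ m))) (sym (ℤₚ.*-identityʳ (ℤ.+ n)))))))
  (fromℚᵘ-homo-+ (integral m) (integral n))

fromℕ-homo-* : ∀ m n → fromℕ (m ℕ.* n) ≡ fromℕ m * fromℕ n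
fromℕ-homo-* m n = trans
  (fromℚᵘ-cong {integral (m ℕ.* n)} {integral m ℚᵘ.* integral n}
    (*≡* (cong (ℤ._* ℤ.+ 1) (ℤₚ.pos-* m n))))
  (fromℚᵘ-homo-* (integral m) (integral n))

fromℕ-suc : ∀ n → fromℕ (suc n) ≡ 1ℚ + fromℕ n
fromℕ-suc n = fromℕ-homo-+ 1 n

1/suc*suc : ∀ n → (ℤ.+ 1 / suc n) * fromℕ (suc n) ≡ 1ℚ
1/suc*suc n = trans (sym (fromℚᵘ-homo-* (mkℚᵘ (ℤ.+ 1) n) (integral (suc n))))
  (fromℚᵘ-cong {mkℚᵘ (ℤ.+ 1) n ℚᵘ.* integral (suc n)} {integral 1}
    (*≡* (cong ℤ.+_ (ℕ-lemma n))))
  where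
  ℕ-lemma : ∀ n → (1 ℕ.* suc n) ℕ.* 1 ≡ 1 ℕ.* (suc n ℕ.* 1)
  ℕ-lemma = ℕ-solve-∀

-- Reciprocal factorials and harmonic numbers

-- Trades division for a factor 1/n!, which the ring solver can treat as an atom.
/!-expˢ : ∀ x n → x /! n ≡ x * expˢ n
/!-expˢ x n = cong (x *_) (sym (*-identityˡ _))

n!*expˢ : ∀ n → fromℕ (n !) * expˢ n ≡ 1ℚ
n!*expˢ n = trans (cong (fromℕ (n !) *_) (*-identityˡ _))
  (*-inverseʳ (fromℕ (n !)) {{fromℕ-nonZero (n !) {{n ℕₚ.!≢0}}}})

suc*expˢ-suc : ∀ n → fromℕ (suc n) * expˢ (suc n) ≡ expˢ n
suc*expˢ-suc n = begin
  s * e                                ≡⟨ *-identityʳ (s * e) ⟨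
  -- The inserted 1 is n! · (1/n!); its n! joins `s` to form (n+1)!, which cancels `e`.
  s * e * 1ℚ                           ≡⟨ cong (s * e *_) (n!*expˢ n) ⟨
  s * e * (f * expˢ n)                 ≡⟨ solve 4 (λ s e f c → s :* e :* (f :* c) := s :* f :* e :* c) refl s e f (expˢ n) ⟩
  s * f * e * expˢ n                   ≡⟨ cong (λ z → z * e * expˢ n) (fromℕ-homo-* (suc n) (n !)) ⟨
  fromℕ (suc n !) * e * expˢ n         ≡⟨ cong (_* expˢ n) (n!*expˢ (suc n)) ⟩
  1ℚ * expˢ n                          ≡⟨ *-identityˡ (expˢ n) ⟩
  expˢ n                               ∎
  where
  s = fromℕ (suc n)
  e = expˢ (suc n)
  f = fromℕ (n !)

∑-last : ∀ n (h : ℕ → ℚ) → ∑[ i < suc n ] h (toℕ i) ≡ ∑[ i < n ] h (toℕ i) + h n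
∑-last n h = trans (sum-init-last {n} (h ∘ toℕ))
  (cong₂ _+_ (sum-cong-≗ {n} (cong h ∘ toℕ-inject₁)) (cong h (toℕ-fromℕ n)))

harmonic-suc : ∀ n → harmonic (suc n) ≡ harmonic n + (ℤ.+ 1 / suc n)
harmonic-suc n = ∑-last n (λ i → ℤ.+ 1 / suc i)

-- Formal power series and their derivative

infixl 6 _⊕_
infixl 7 _·_

_⊕_ : PowerSeries → PowerSeries → PowerSeries
(a ⊕ b) n = a n + b n

_·_ : ℚ → PowerSeries → PowerSeries
(x · a) n = x * a n

D : PowerSeries → PowerSeries
D a n = fromℕ (suc n) * a (suc n)

⊛-cong : ∀ {a a′ b b′} → a ≗ a′ → b ≗ b′ → a ⊛ b ≗ a′ ⊛ b′
⊛-cong a≗a′ b≗b′ n = sum-cong-≗ {suc n} λ i → cong₂ _*_ (a≗a′ (toℕ i)) (b≗b′ (n ∸ toℕ i))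

⊛-distribʳ-⊕ : ∀ c a b → (a ⊕ b) ⊛ c ≗ (a ⊛ c) ⊕ (b ⊛ c)
⊛-distribʳ-⊕ c a b n = trans
  (sum-cong-≗ {suc n} λ i → *-distribʳ-+ (c (n ∸ toℕ i)) (a (toℕ i)) (b (toℕ i)))
  (∑-distrib-+ {suc n} (λ i → a (toℕ i) * c (n ∸ toℕ i)) (λ i → b (toℕ i) * c (n ∸ toℕ i)))

⊛-distribˡ-⊕ : ∀ c a b → c ⊛ (a ⊕ b) ≗ (c ⊛ a) ⊕ (c ⊛ b)
⊛-distribˡ-⊕ c a b n = trans
  (sum-cong-≗ {suc n} λ i → *-distribˡ-+ (c (toℕ i)) (a (n ∸ toℕ i)) (b (n ∸ toℕ i)))
  (∑-distrib-+ {suc n} (λ i → c (toℕ i) * a (n ∸ toℕ i)) (λ i → c (toℕ i) * b (n ∸ toℕ i)))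

⊛-·-comm : ∀ x a b → a ⊛ (x · b) ≗ x · (a ⊛ b)
⊛-·-comm x a b n = trans
  (sum-cong-≗ {suc n} λ i → solve 3 (λ x y z → y :* (x :* z) := x :* (y :* z)) refl
    x (a (toℕ i)) (b (n ∸ toℕ i)))
  (sym (*-distribˡ-sum {suc n} x (λ i → a (toℕ i) * b (n ∸ toℕ i))))

⊛-identityˡ : ∀ a → 1ˢ ⊛ a ≗ a
⊛-identityˡ a n = begin
  1ℚ * a n + ∑[ i < n ] (0ℚ * a (n ∸ suc (toℕ i)))
    ≡⟨ cong (1ℚ * a n +_) (*-distribˡ-sum {n} 0ℚ (λ i → a (n ∸ suc (toℕ i)))) ⟨
  1ℚ * a n + 0ℚ * ∑[ i < n ] a (n ∸ suc (toℕ i))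
    ≡⟨ solve 2 (λ x y → con 1ℚ :* x :+ con 0ℚ :* y := x) refl (a n)
         (∑[ i < n ] a (n ∸ suc (toℕ i))) ⟩
  a n ∎

-- In the coefficient of tⁿ⁺¹, the weight n + 1 of the i-th product splits as i + (n + 1 - i). The
-- first part kills the term i = 0 and the second the term i = n + 1, so each half is a convolution
-- of length n.
D-⊛ : ∀ a b → D (a ⊛ b) ≗ (D a ⊛ b) ⊕ (a ⊛ D b)
D-⊛ a b n = begin
  fromℕ N * ∑[ i ≤ N ] (a (toℕ i) * b (N ∸ toℕ i))
    ≡⟨ *-distribˡ-sum {suc N} (fromℕ N) (λ i → a (toℕ i) * b (N ∸ toℕ i)) ⟩
  ∑[ i ≤ N ] (fromℕ N * (a (toℕ i) * b (N ∸ toℕ i)))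
    ≡⟨ sum-cong-≗ {suc N} split ⟩
  ∑[ i ≤ N ] (left (toℕ i) + right (toℕ i))
    ≡⟨ ∑-distrib-+ {suc N} (left ∘ toℕ) (right ∘ toℕ) ⟩
  ∑[ i ≤ N ] left (toℕ i) + ∑[ i ≤ N ] right (toℕ i)
    ≡⟨ cong₂ _+_ left-sum right-sum ⟩
  (D a ⊛ b) n + (a ⊛ D b) n ∎
  where
  N = suc n

  left right : ℕ → ℚ
  left i = fromℕ i * a i * b (N ∸ i)
  right i = a i * (fromℕ (N ∸ i) * b (N ∸ i))

  split : ∀ (i : Fin (suc N)) →
    fromℕ N * (a (toℕ i) * b (N ∸ toℕ i)) ≡ left (toℕ i) + right (toℕ i)
  split i = trans
    (cong (λ z → z * (a k * b (N ∸ k)))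
      (trans (cong fromℕ (sym (ℕₚ.m+[n∸m]≡n (toℕ≤pred[n] i)))) (fromℕ-homo-+ k (N ∸ k))))
    (solve 4 (λ x y u v → (x :+ y) :* (u :* v) := x :* u :* v :+ u :* (y :* v)) refl
      (fromℕ k) (fromℕ (N ∸ k)) (a k) (b (N ∸ k)))
    where k = toℕ i

  left-sum : ∑[ i ≤ N ] left (toℕ i) ≡ (D a ⊛ b) n
  -- Past the vanishing term i = 0, the summands at i + 1 are those of `D a ⊛ b` by computation.
  left-sum = solve 3 (λ x y z → con 0ℚ :* x :* y :+ z := z) refl (a 0) (b N) ((D a ⊛ b) n)

  right-sum : ∑[ i ≤ N ] right (toℕ i) ≡ (a ⊛ D b) n
  right-sum = begin
    ∑[ i ≤ N ] right (toℕ i)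
      ≡⟨ ∑-last N right ⟩
    ∑[ i < N ] right (toℕ i) + right N
      -- For i ≤ n, `suc n ∸ i` has to become `suc (n ∸ i)` before the coefficient of `D b` appears.
      ≡⟨ cong₂ _+_
           (sum-cong-≗ {N} λ i → cong (λ m → a (toℕ i) * (fromℕ m * b m))
             (ℕₚ.+-∸-assoc 1 (toℕ≤pred[n] i)))
           (cong (λ m → a N * (fromℕ m * b m)) (ℕₚ.n∸n≡0 N)) ⟩
    (a ⊛ D b) n + a N * (0ℚ * b 0)
      ≡⟨ solve 3 (λ x y z → z :+ x :* (con 0ℚ :* y) := z) refl (a N) (b 0) ((a ⊛ D b) n) ⟩
    (a ⊛ D b) n ∎

-- Derivatives of the powers of E = eᵗ - 1

expm1ˢ : PowerSeries
expm1ˢ = expˢ ⊖ 1ˢ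

D-expm1ˢ : D expm1ˢ ≗ expm1ˢ ⊕ 1ˢ
D-expm1ˢ n = begin
  fromℕ (suc n) * (expˢ (suc n) - 0ℚ)
    ≡⟨ solve 2 (λ x y → x :* (y :- con 0ℚ) := x :* y) refl (fromℕ (suc n)) (expˢ (suc n)) ⟩
  fromℕ (suc n) * expˢ (suc n)
    ≡⟨ suc*expˢ-suc n ⟩
  expˢ n
    ≡⟨ solve 2 (λ x y → x := x :- y :+ y) refl (expˢ n) (1ˢ n) ⟩
  expˢ n - 1ˢ n + 1ˢ n ∎

mutual
  -- Leibniz rule on E · Eᵏ: the term E′Eᵏ contributes Eᵏ⁺¹ + Eᵏ once, and the term E(Eᵏ)′
  -- contributes it k times.
  D-expm1ˢ-^ : ∀ k → D (expm1ˢ ^ˢ suc k) ≗ fromℕ (suc k) · (expm1ˢ ^ˢ suc k ⊕ expm1ˢ ^ˢ k)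
  D-expm1ˢ-^ k n = begin
    D (expm1ˢ ⊛ P) n
      ≡⟨ D-⊛ expm1ˢ P n ⟩
    (D expm1ˢ ⊛ P) n + (expm1ˢ ⊛ D P) n
      ≡⟨ cong₂ _+_
           (trans (⊛-cong {b = P} D-expm1ˢ (λ _ → refl) n)
             (trans (⊛-distribʳ-⊕ P expm1ˢ 1ˢ n) (cong (Q n +_) (⊛-identityˡ P n))))
           (expm1ˢ⊛D k n) ⟩
    Q n + P n + fromℕ k * (Q n + P n)
      ≡⟨ solve 2 (λ x y → y :+ x :* y := (con 1ℚ :+ x) :* y) refl (fromℕ k) (Q n + P n) ⟩
    (1ℚ + fromℕ k) * (Q n + P n)
      ≡⟨ cong (_* (Q n + P n)) (fromℕ-suc k) ⟨
    fromℕ (suc k) * (Q n + P n) ∎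
    where
    P = expm1ˢ ^ˢ k
    Q = expm1ˢ ^ˢ suc k

  -- The extra factor E keeps Eᵏ⁻¹ out of the formula, so that k = 0 fits the same pattern. For
  -- positive exponents it is E times the preceding formula at the previous exponent.
  expm1ˢ⊛D : ∀ k → expm1ˢ ⊛ D (expm1ˢ ^ˢ k) ≗ fromℕ k · (expm1ˢ ^ˢ suc k ⊕ expm1ˢ ^ˢ k)
  expm1ˢ⊛D zero n = begin
    (expm1ˢ ⊛ D 1ˢ) n
      -- The zero derivative is written as a multiple of `1ˢ` so that the scalar 0 can be pulled out
      -- of the product.
      ≡⟨ ⊛-cong {expm1ˢ} {b = D 1ˢ} {0ℚ · 1ˢ} (λ _ → refl)
           (λ m → trans (*-zeroʳ (fromℕ (suc m))) (sym (*-zeroˡ (1ˢ m)))) n ⟩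
    (expm1ˢ ⊛ (0ℚ · 1ˢ)) n
      ≡⟨ ⊛-·-comm 0ℚ expm1ˢ 1ˢ n ⟩
    0ℚ * (expm1ˢ ⊛ 1ˢ) n
      ≡⟨ solve 2 (λ x y → con 0ℚ :* x := con 0ℚ :* y) refl
           ((expm1ˢ ⊛ 1ˢ) n) ((expm1ˢ ⊛ 1ˢ) n + 1ˢ n) ⟩
    0ℚ * ((expm1ˢ ⊛ 1ˢ) n + 1ˢ n) ∎
  expm1ˢ⊛D (suc k) n = begin
    (expm1ˢ ⊛ D Q) n
      ≡⟨ ⊛-cong {expm1ˢ} (λ _ → refl) (D-expm1ˢ-^ k) n ⟩
    (expm1ˢ ⊛ (fromℕ (suc k) · (Q ⊕ P))) n
      ≡⟨ ⊛-·-comm (fromℕ (suc k)) expm1ˢ (Q ⊕ P) n ⟩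
    fromℕ (suc k) * (expm1ˢ ⊛ (Q ⊕ P)) n
      ≡⟨ cong (fromℕ (suc k) *_) (⊛-distribˡ-⊕ expm1ˢ Q P n) ⟩
    fromℕ (suc k) * ((expm1ˢ ⊛ Q) n + Q n) ∎
    where
    P = expm1ˢ ^ˢ k
    Q = expm1ˢ ^ˢ suc k

-- Recurrence and boundary values of the Stirling numbers

-- Compares coefficients of tⁿ in (Eᵏ⁺¹)′ = (k + 1)(Eᵏ⁺¹ + Eᵏ). The factor n + 1 of (n + 1)!
-- produces the derivative, and on Eᵏ the factor k + 1 turns 1/(k + 1)! into 1/k!.
stirling₂-suc-suc : ∀ n k →
  stirling₂ (suc n) (suc k) ≡ fromℕ (suc k) * stirling₂ n (suc k) + stirling₂ n k
stirling₂-suc-suc n k = begin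
  fromℕ (suc n !) * (Q (suc n) /! suc k)
    ≡⟨ cong₂ _*_ (fromℕ-homo-* (suc n) (n !)) (/!-expˢ (Q (suc n)) (suc k)) ⟩
  fromℕ (suc n) * f * (Q (suc n) * e)
    ≡⟨ solve 4 (λ s f q e → s :* f :* (q :* e) := f :* (s :* q :* e)) refl
         (fromℕ (suc n)) f (Q (suc n)) e ⟩
  f * (D Q n * e)
    ≡⟨ cong (λ z → f * (z * e)) (D-expm1ˢ-^ k n) ⟩
  f * (s * (Q n + P n) * e)
    ≡⟨ solve 5 (λ f s q p e → f :* (s :* (q :+ p) :* e)
                  := s :* (f :* (q :* e)) :+ f :* (p :* (s :* e))) refl
         f s (Q n) (P n) e ⟩
  s * (f * (Q n * e)) + f * (P n * (s * e))
    ≡⟨ cong₂ _+_ (cong (λ z → s * (f * z)) (sym (/!-expˢ (Q n) (suc k))))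
         (cong (f *_) (trans (cong (P n *_) (suc*expˢ-suc k)) (sym (/!-expˢ (P n) k)))) ⟩
  s * stirling₂ n (suc k) + stirling₂ n k ∎
  where
  P = expm1ˢ ^ˢ k
  Q = expm1ˢ ^ˢ suc k
  f = fromℕ (n !)
  s = fromℕ (suc k)
  e = expˢ (suc k)

stirling₂-suc-zero : ∀ n → stirling₂ (suc n) 0 ≡ 0ℚ
stirling₂-suc-zero n = *-zeroʳ (fromℕ (suc n !))

-- E has constant term 0, hence so has every positive power of it.
stirling₂-zero-suc : ∀ k → stirling₂ 0 (suc k) ≡ 0ℚ
stirling₂-zero-suc k = begin
  1ℚ * ((0ℚ * P 0 + 0ℚ) /! suc k)
    ≡⟨ cong (1ℚ *_) (/!-expˢ (0ℚ * P 0 + 0ℚ) (suc k)) ⟩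
  1ℚ * ((0ℚ * P 0 + 0ℚ) * expˢ (suc k))
    ≡⟨ solve 2 (λ x y → con 1ℚ :* ((con 0ℚ :* x :+ con 0ℚ) :* y) := con 0ℚ) refl (P 0) (expˢ (suc k)) ⟩
  0ℚ ∎
  where P = expm1ˢ ^ˢ k

stirling₂-< : ∀ {n k} → n ℕ.< k → stirling₂ n k ≡ 0ℚ
stirling₂-< {zero}  {suc k} _ = stirling₂-zero-suc k
stirling₂-< {suc n} {suc k} (ℕ.s≤s n<k) = begin
  stirling₂ (suc n) (suc k)
    ≡⟨ stirling₂-suc-suc n k ⟩
  fromℕ (suc k) * stirling₂ n (suc k) + stirling₂ n k
    ≡⟨ cong₂ (λ u v → fromℕ (suc k) * u + v) (stirling₂-< (ℕₚ.m<n⇒m<1+n n<k)) (stirling₂-< n<k) ⟩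
  fromℕ (suc k) * 0ℚ + 0ℚ
    ≡⟨ solve 1 (λ x → x :* con 0ℚ :+ con 0ℚ := con 0ℚ) refl (fromℕ (suc k)) ⟩
  0ℚ ∎

stirling₂-diagonal : ∀ n → stirling₂ n n ≡ 1ℚ
stirling₂-diagonal zero    = refl
stirling₂-diagonal (suc n) = begin
  stirling₂ (suc n) (suc n)
    ≡⟨ stirling₂-suc-suc n n ⟩
  fromℕ (suc n) * stirling₂ n (suc n) + stirling₂ n n
    ≡⟨ cong₂ (λ u v → fromℕ (suc n) * u + v) (stirling₂-< (ℕₚ.n<1+n n)) (stirling₂-diagonal n) ⟩
  fromℕ (suc n) * 0ℚ + 1ℚ
    ≡⟨ solve 1 (λ x → x :* con 0ℚ :+ con 1ℚ := con 1ℚ) refl (fromℕ (suc n)) ⟩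
  1ℚ ∎

-- Sums weighted by Stirling numbers

stirlingSum : ℕ → (ℕ → ℚ) → ℚ
stirlingSum n h = ∑[ k ≤ n ] (stirling₂ n (toℕ k) * h (toℕ k))

stirlingSum-cong : ∀ n {h h′} → h ≗ h′ → stirlingSum n h ≡ stirlingSum n h′
stirlingSum-cong n h≗h′ = sum-cong-≗ {suc n} λ k → cong (stirling₂ n (toℕ k) *_) (h≗h′ (toℕ k))

stirlingSum-* : ∀ n x h → stirlingSum n (λ k → x * h k) ≡ x * stirlingSum n h
stirlingSum-* n x h = trans
  (sum-cong-≗ {suc n} λ k → solve 3 (λ s x y → s :* (x :* y) := x :* (s :* y)) refl
    (stirling₂ n (toℕ k)) x (h (toℕ k)))
  (sym (*-distribˡ-sum {suc n} x (λ k → stirling₂ n (toℕ k) * h (toℕ k))))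

stirlingSum-+ : ∀ n h h′ → stirlingSum n (λ k → h k + h′ k) ≡ stirlingSum n h + stirlingSum n h′
stirlingSum-+ n h h′ = trans
  (sum-cong-≗ {suc n} λ k → *-distribˡ-+ (stirling₂ n (toℕ k)) (h (toℕ k)) (h′ (toℕ k)))
  (∑-distrib-+ {suc n} (λ k → stirling₂ n (toℕ k) * h (toℕ k))
    (λ k → stirling₂ n (toℕ k) * h′ (toℕ k)))

-- Summation by parts: the recurrence is moved from the Stirling numbers onto `h`, which makes
-- induction on n possible for any `h` that behaves well under the resulting operator.
stirlingSum-suc : ∀ n h → stirlingSum (suc n) h ≡ stirlingSum n (λ k → fromℕ k * h k + h (suc k))
stirlingSum-suc n h = begin
  stirling₂ (suc n) 0 * h 0 + ∑[ k ≤ n ] (stirling₂ (suc n) (suc (toℕ k)) * h (suc (toℕ k)))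
    ≡⟨ cong₂ _+_ (trans (cong (_* h 0) (stirling₂-suc-zero n)) (*-zeroˡ (h 0)))
         (sum-cong-≗ {suc n} λ k → split (toℕ k)) ⟩
  0ℚ + ∑[ k ≤ n ] (weighted (suc (toℕ k)) + shifted (toℕ k))
    ≡⟨ cong (0ℚ +_) (∑-distrib-+ {suc n} (weighted ∘ suc ∘ toℕ) (shifted ∘ toℕ)) ⟩
  0ℚ + (∑[ k ≤ n ] weighted (suc (toℕ k)) + ∑[ k ≤ n ] shifted (toℕ k))
    -- The leading 0 is recast as `weighted 0`, whose factor k is 0, so that the sum starts at k =
    -- 0.
    ≡⟨ solve 3 (λ u v z → con 0ℚ :+ (u :+ v) := (con 0ℚ :* z :+ u) :+ v) refl
         (∑[ k ≤ n ] weighted (suc (toℕ k))) (∑[ k ≤ n ] shifted (toℕ k)) (stirling₂ n 0 * h 0) ⟩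
  ∑[ k ≤ suc n ] weighted (toℕ k) + ∑[ k ≤ n ] shifted (toℕ k)
    -- The top term k = n + 1 drops out because S(n, n + 1) = 0.
    ≡⟨ cong (_+ ∑[ k ≤ n ] shifted (toℕ k)) (trans (∑-last (suc n) weighted)
         (trans (cong (∑[ k ≤ n ] weighted (toℕ k) +_) weighted-last)
           (+-identityʳ (∑[ k ≤ n ] weighted (toℕ k))))) ⟩
  ∑[ k ≤ n ] weighted (toℕ k) + ∑[ k ≤ n ] shifted (toℕ k)
    ≡⟨ ∑-distrib-+ {suc n} (weighted ∘ toℕ) (shifted ∘ toℕ) ⟨
  ∑[ k ≤ n ] (weighted (toℕ k) + shifted (toℕ k))
    ≡⟨ sum-cong-≗ {suc n} (λ k → solve 4 (λ x s y z → x :* (s :* y) :+ s :* z := s :* (x :* y :+ z))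
         refl (fromℕ (toℕ k)) (stirling₂ n (toℕ k)) (h (toℕ k)) (h (suc (toℕ k)))) ⟩
  stirlingSum n (λ k → fromℕ k * h k + h (suc k)) ∎
  where
  weighted shifted : ℕ → ℚ
  weighted k = fromℕ k * (stirling₂ n k * h k)
  shifted k = stirling₂ n k * h (suc k)

  split : ∀ k → stirling₂ (suc n) (suc k) * h (suc k) ≡ weighted (suc k) + shifted k
  split k = trans (cong (_* h (suc k)) (stirling₂-suc-suc n k))
    (solve 4 (λ x s t y → (x :* s :+ t) :* y := x :* (s :* y) :+ t :* y) refl
      (fromℕ (suc k)) (stirling₂ n (suc k)) (stirling₂ n k) (h (suc k)))

  weighted-last : weighted (suc n) ≡ 0ℚ
  weighted-last = trans (cong (λ z → fromℕ (suc n) * (z * h (suc n))) (stirling₂-< (ℕₚ.n<1+n n)))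
    (solve 2 (λ x y → x :* (con 0ℚ :* y) := con 0ℚ) refl (fromℕ (suc n)) (h (suc n)))

-- Falling factorials and the expansion of xⁿ

-- fall′ x k is the derivative of fall x k with respect to x.
fall fall′ : ℚ → ℕ → ℚ
fall x zero     = 1ℚ
fall x (suc k)  = fall x k * (x - fromℕ k)
fall′ x zero    = 0ℚ
fall′ x (suc k) = fall x k + fall′ x k * (x - fromℕ k)

-- Since k · (x)ₖ + (x)ₖ₊₁ = x · (x)ₖ, each step of the recurrence multiplies the sum by x.
stirlingSum-fall : ∀ p n → stirlingSum n (fall (fromℕ p)) ≡ fromℕ (p ^ n)
stirlingSum-fall p zero    = refl
stirlingSum-fall p (suc n) = begin
  stirlingSum (suc n) (fall x)
    ≡⟨ stirlingSum-suc n (fall x) ⟩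
  stirlingSum n (λ k → fromℕ k * fall x k + fall x k * (x - fromℕ k))
    ≡⟨ stirlingSum-cong n (λ k → solve 3 (λ i f x → i :* f :+ f :* (x :- i) := x :* f)
         refl (fromℕ k) (fall x k) x) ⟩
  stirlingSum n (λ k → x * fall x k)
    ≡⟨ stirlingSum-* n x (fall x) ⟩
  x * stirlingSum n (fall x)
    ≡⟨ cong (x *_) (stirlingSum-fall p n) ⟩
  x * fromℕ (p ^ n)
    ≡⟨ fromℕ-homo-* p (p ^ n) ⟨
  fromℕ (p ^ suc n) ∎
  where x = fromℕ p

-- Differentiating k · (x)ₖ + (x)ₖ₊₁ = x · (x)ₖ adds the term (x)ₖ, so the sums obey the product
-- rule for x · xⁿ. At n = 0 the factor n hides the truncated exponent.
stirlingSum-fall′ : ∀ p n → stirlingSum n (fall′ (fromℕ p)) ≡ fromℕ (n ℕ.* p ^ (n ∸ 1))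
stirlingSum-fall′ p zero    = refl
stirlingSum-fall′ p (suc n) = begin
  stirlingSum (suc n) (fall′ x)
    ≡⟨ stirlingSum-suc n (fall′ x) ⟩
  stirlingSum n (λ k → fromℕ k * fall′ x k + (fall x k + fall′ x k * (x - fromℕ k)))
    ≡⟨ stirlingSum-cong n (λ k → solve 4 (λ i f g x → i :* g :+ (f :+ g :* (x :- i)) := x :* g :+ f)
         refl (fromℕ k) (fall x k) (fall′ x k) x) ⟩
  stirlingSum n (λ k → x * fall′ x k + fall x k)
    ≡⟨ stirlingSum-+ n (λ k → x * fall′ x k) (fall x) ⟩
  stirlingSum n (λ k → x * fall′ x k) + stirlingSum n (fall x)
    ≡⟨ cong₂ _+_ (trans (stirlingSum-* n x (fall′ x)) (cong (x *_) (stirlingSum-fall′ p n)))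
         (stirlingSum-fall p n) ⟩
  x * fromℕ (n ℕ.* p ^ (n ∸ 1)) + fromℕ (p ^ n)
    ≡⟨ cong (_+ fromℕ (p ^ n)) (fromℕ-homo-* p (n ℕ.* p ^ (n ∸ 1))) ⟨
  fromℕ (p ℕ.* (n ℕ.* p ^ (n ∸ 1))) + fromℕ (p ^ n)
    ≡⟨ fromℕ-homo-+ (p ℕ.* (n ℕ.* p ^ (n ∸ 1))) (p ^ n) ⟨
  fromℕ (p ℕ.* (n ℕ.* p ^ (n ∸ 1)) ℕ.+ p ^ n)
    ≡⟨ cong fromℕ (power-rule n) ⟩
  fromℕ (suc n ℕ.* p ^ n) ∎
  where
  x = fromℕ p

  power-rule : ∀ n → p ℕ.* (n ℕ.* p ^ (n ∸ 1)) ℕ.+ p ^ n ≡ suc n ℕ.* p ^ n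
  power-rule zero    = cong (ℕ._+ 1) (ℕₚ.*-zeroʳ p)
  power-rule (suc n) = ℕ-lemma p n (p ^ n)
    where
    ℕ-lemma : ∀ p n q → p ℕ.* (suc n ℕ.* q) ℕ.+ p ℕ.* q ≡ suc (suc n) ℕ.* (p ℕ.* q)
    ℕ-lemma = ℕ-solve-∀

-- Falling factorials at x = p, divided by p!

fromℕ-∸ : ∀ {k m p} → k ℕ.+ m ≡ p → fromℕ p - fromℕ k ≡ fromℕ m
fromℕ-∸ {k} {m} refl = trans (cong (_- fromℕ k) (fromℕ-homo-+ k m))
  (solve 2 (λ x y → x :+ y :- x := y) refl (fromℕ k) (fromℕ m))

-- Each new factor p - k equals m + 1 and cancels the top factor of (m + 1)!. Writing the hypothesis
-- as k + m = p avoids truncated subtraction in the induction.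
fall-expˢ : ∀ k {m p} → k ℕ.+ m ≡ p → fall (fromℕ p) k * expˢ p ≡ expˢ m
fall-expˢ zero    {m} refl = *-identityˡ (expˢ m)
fall-expˢ (suc k) {m} {p} k+1+m≡p = begin
  f * (fromℕ p - fromℕ k) * e  ≡⟨ solve 3 (λ f y e → f :* y :* e := y :* (f :* e)) refl f _ e ⟩
  (fromℕ p - fromℕ k) * (f * e) ≡⟨ cong₂ _*_ (fromℕ-∸ {k} k+m+1≡p) (fall-expˢ k k+m+1≡p) ⟩
  fromℕ (suc m) * expˢ (suc m) ≡⟨ suc*expˢ-suc m ⟩
  expˢ m                       ∎
  where
  f = fall (fromℕ p) k
  e = expˢ p
  k+m+1≡p = trans (ℕₚ.+-suc k m) k+1+m≡p

-- Logarithmic differentiation: the derivative is the product times the sum of 1/(p - i) over i < k,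
-- and that sum is the difference of the two harmonic numbers. The induction adds one such
-- reciprocal at a time.
fall′-expˢ : ∀ k {m p} → k ℕ.+ m ≡ p →
  fall′ (fromℕ p) k * expˢ p ≡ expˢ m * (harmonic p - harmonic m)
fall′-expˢ zero    {m} refl =
  solve 2 (λ e h → con 0ℚ :* e := e :* (h :- h)) refl (expˢ m) (harmonic m)
fall′-expˢ (suc k) {m} {p} k+1+m≡p = begin
  (f + g * y) * e
    ≡⟨ solve 4 (λ f g y e → (f :+ g :* y) :* e := f :* e :+ y :* (g :* e)) refl f g y e ⟩
  f * e + y * (g * e)
    ≡⟨ cong₂ _+_ (fall-expˢ k k+m+1≡p)
         (cong₂ _*_ (fromℕ-∸ {k} k+m+1≡p) (fall′-expˢ k k+m+1≡p)) ⟩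
  e₁ + s * (e₁ * (harmonic p - harmonic (suc m)))
    -- The first 1/(m + 1)! is expanded by 1 = `r * s`, to cancel the `r` that splits off from the
    -- harmonic number of m + 1.
    ≡⟨ cong₂ (λ u v → u + s * (e₁ * (harmonic p - v)))
         (trans (sym (*-identityˡ e₁)) (cong (_* e₁) (sym (1/suc*suc m)))) (harmonic-suc m) ⟩
  r * s * e₁ + s * (e₁ * (harmonic p - (harmonic m + r)))
    ≡⟨ solve 5 (λ r s e h h′ → r :* s :* e :+ s :* (e :* (h :- (h′ :+ r))) := s :* e :* (h :- h′))
         refl r s e₁ (harmonic p) (harmonic m) ⟩
  s * e₁ * (harmonic p - harmonic m)
    ≡⟨ cong (_* (harmonic p - harmonic m)) (suc*expˢ-suc m) ⟩
  expˢ m * (harmonic p - harmonic m) ∎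
  where
  f = fall (fromℕ p) k
  g = fall′ (fromℕ p) k
  y = fromℕ p - fromℕ k
  e = expˢ p
  e₁ = expˢ (suc m)
  s = fromℕ (suc m)
  r = ℤ.+ 1 / suc m
  k+m+1≡p = trans (ℕₚ.+-suc k m) k+1+m≡p

-- The two identities at n = p + 1 and their combination

-- The top term, whose Stirling number is 1, is kept apart because the closed forms with 1/(p - k)!
-- hold only for k ≤ p.
stirlingSum-last : ∀ n c (h h′ : ℕ → ℚ) → (∀ k → k ℕ.≤ n → h k * c ≡ h′ k) →
  stirlingSum (suc n) h * c ≡ ∑[ k ≤ n ] (stirling₂ (suc n) (toℕ k) * h′ (toℕ k)) + h (suc n) * c
stirlingSum-last n c h h′ h*c≗h′ = begin
  stirlingSum (suc n) h * c
    ≡⟨ cong (_* c) (∑-last (suc n) (λ k → S k * h k)) ⟩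
  (∑[ k ≤ n ] (S (toℕ k) * h (toℕ k)) + S (suc n) * h (suc n)) * c
    ≡⟨ cong (λ z → (∑[ k ≤ n ] (S (toℕ k) * h (toℕ k)) + z * h (suc n)) * c)
         (stirling₂-diagonal (suc n)) ⟩
  (∑[ k ≤ n ] (S (toℕ k) * h (toℕ k)) + 1ℚ * h (suc n)) * c
    ≡⟨ solve 3 (λ s h c → (s :+ con 1ℚ :* h) :* c := s :* c :+ h :* c) refl
         (∑[ k ≤ n ] (S (toℕ k) * h (toℕ k))) (h (suc n)) c ⟩
  ∑[ k ≤ n ] (S (toℕ k) * h (toℕ k)) * c + h (suc n) * c
    ≡⟨ cong (_+ h (suc n) * c) (trans
         (*-distribʳ-sum {suc n} c (λ k → S (toℕ k) * h (toℕ k)))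
         (sum-cong-≗ {suc n} λ k → trans (*-assoc (S (toℕ k)) (h (toℕ k)) c)
           (cong (S (toℕ k) *_) (h*c≗h′ (toℕ k) (toℕ≤pred[n] k))))) ⟩
  ∑[ k ≤ n ] (S (toℕ k) * h′ (toℕ k)) + h (suc n) * c ∎
  where
  S : ℕ → ℚ
  S = stirling₂ (suc n)

∑-stirling₂-expˢ : ∀ p →
  ∑[ k ≤ p ] (stirling₂ (suc p) (toℕ k) * expˢ (p ∸ toℕ k)) ≡ fromℕ (p ^ suc p) * expˢ p
∑-stirling₂-expˢ p = sym (begin
  fromℕ (p ^ suc p) * e
    ≡⟨ cong (_* e) (stirlingSum-fall p (suc p)) ⟨
  stirlingSum (suc p) (fall x) * e
    ≡⟨ stirlingSum-last p e (fall x) (λ k → expˢ (p ∸ k))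
         (λ k k≤p → fall-expˢ k (ℕₚ.m+[n∸m]≡n k≤p)) ⟩
  A + fall x p * (x - x) * e
    -- The falling factorial of length p + 1 contains the factor p - p.
    ≡⟨ solve 4 (λ a f x e → a :+ f :* (x :- x) :* e := a) refl A (fall x p) x e ⟩
  A ∎)
  where
  x = fromℕ p
  e = expˢ p
  A = ∑[ k ≤ p ] (stirling₂ (suc p) (toℕ k) * expˢ (p ∸ toℕ k))

-- The summand 1 is the term k = p + 1: of the derivative at p only the part that differentiates the
-- factor x - p survives, leaving p!/p!.
∑-stirling₂-expˢ-harmonic : ∀ p →
  ∑[ k ≤ p ] (stirling₂ (suc p) (toℕ k) * (expˢ (p ∸ toℕ k) * (harmonic p - harmonic (p ∸ toℕ k)))) + 1ℚ
    ≡ fromℕ (suc p ℕ.* p ^ p) * expˢ p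
∑-stirling₂-expˢ-harmonic p = sym (begin
  fromℕ (suc p ℕ.* p ^ p) * e
    ≡⟨ cong (_* e) (stirlingSum-fall′ p (suc p)) ⟨
  stirlingSum (suc p) (fall′ x) * e
    ≡⟨ stirlingSum-last p e (fall′ x)
         (λ k → expˢ (p ∸ k) * (harmonic p - harmonic (p ∸ k)))
         (λ k k≤p → fall′-expˢ k (ℕₚ.m+[n∸m]≡n k≤p)) ⟩
  B + (fall x p + fall′ x p * (x - x)) * e
    ≡⟨ solve 5 (λ b f g x e → b :+ (f :+ g :* (x :- x)) :* e := b :+ f :* e)
         refl B (fall x p) (fall′ x p) x e ⟩
  B + fall x p * e
    ≡⟨ cong (B +_) (fall-expˢ p (ℕₚ.+-identityʳ p)) ⟩
  B + 1ℚ ∎)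
  where
  x = fromℕ p
  e = expˢ p
  B = ∑[ k ≤ p ] (stirling₂ (suc p) (toℕ k) * (expˢ (p ∸ toℕ k) * (harmonic p - harmonic (p ∸ toℕ k))))

∑-stirling₂-harmonic : ∀ p →
  ∑[ i < p ] (let j = suc (toℕ i) in stirling₂ (suc p) (p ∸ j) * (harmonic j /! j))
    ≡ (fromℕ (p !) - fromℕ (suc p ℕ.* p ^ p) + fromℕ (p ^ suc p) * harmonic p) /! p
∑-stirling₂-harmonic p = begin
  ∑[ i < p ] (S (p ∸ suc (toℕ i)) * (harmonic (suc (toℕ i)) /! suc (toℕ i)))
    -- The substitution j = p - k reverses the order of summation and brings in the range k < p.
    ≡⟨ sum-cong-≗ {p} reindex ⟩
  ∑[ i < p ] t (toℕ (opposite i))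
    ≡⟨ ∑-permute {p} (t ∘ toℕ) Perm.reverse ⟨
  ∑[ k < p ] t (toℕ k)
    ≡⟨ +-identityʳ _ ⟨
  ∑[ k < p ] t (toℕ k) + 0ℚ
    -- The term k = p may be added because the harmonic number of 0 is 0; the range then matches
    -- that of the two identities.
    ≡⟨ cong (∑[ k < p ] t (toℕ k) +_) t-last ⟨
  ∑[ k < p ] t (toℕ k) + t p
    ≡⟨ ∑-last p t ⟨
  T
    -- Both `B + 1ℚ` and `B + T` have closed forms: the former is the derivative identity, and in
    -- the latter the inner harmonic numbers cancel, leaving `H` times the first identity.
    ≡⟨ solve 2 (λ b t → t := con 1ℚ :- (b :+ con 1ℚ) :+ (b :+ t)) refl B T ⟩
  1ℚ - (B + 1ℚ) + (B + T)
    ≡⟨ cong₂ (λ u v → 1ℚ - u + v) (∑-stirling₂-expˢ-harmonic p) B+T ⟩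
  1ℚ - v * e + w * e * H
    -- The isolated 1 becomes p!/p!, the source of p! in the numerator.
    ≡⟨ cong (λ z → z - v * e + w * e * H) (n!*expˢ p) ⟨
  fromℕ (p !) * e - v * e + w * e * H
    ≡⟨ solve 5 (λ f v w e h → f :* e :- v :* e :+ w :* e :* h := (f :- v :+ w :* h) :* e)
         refl (fromℕ (p !)) v w e H ⟩
  (fromℕ (p !) - v + w * H) * e
    ≡⟨ /!-expˢ (fromℕ (p !) - v + w * H) p ⟨
  (fromℕ (p !) - v + w * H) /! p ∎
  where
  S t d : ℕ → ℚ
  S = stirling₂ (suc p)
  t k = S k * (expˢ (p ∸ k) * harmonic (p ∸ k))
  d k = S k * (expˢ (p ∸ k) * (harmonic p - harmonic (p ∸ k)))
  H = harmonic p
  e = expˢ p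
  v = fromℕ (suc p ℕ.* p ^ p)
  w = fromℕ (p ^ suc p)
  B = ∑[ k ≤ p ] d (toℕ k)
  T = ∑[ k ≤ p ] t (toℕ k)

  reindex : ∀ (i : Fin p) →
    S (p ∸ suc (toℕ i)) * (harmonic (suc (toℕ i)) /! suc (toℕ i)) ≡ t (toℕ (opposite i))
  reindex i = begin
    S (p ∸ j) * (harmonic j /! j)
      ≡⟨ cong (S (p ∸ j) *_) (trans (/!-expˢ (harmonic j) j) (*-comm (harmonic j) (expˢ j))) ⟩
    S (p ∸ j) * (expˢ j * harmonic j)
      ≡⟨ cong (λ m → S (p ∸ j) * (expˢ m * harmonic m)) (ℕₚ.m∸[m∸n]≡n (toℕ<n i)) ⟨
    t (p ∸ j)
      ≡⟨ cong t (opposite-prop i) ⟨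
    t (toℕ (opposite i)) ∎
    where j = suc (toℕ i)

  t-last : t p ≡ 0ℚ
  t-last = trans (cong (λ m → S p * (expˢ m * harmonic m)) (ℕₚ.n∸n≡0 p)) (*-zeroʳ (S p))

  B+T : B + T ≡ w * e * H
  B+T = begin
    B + T
      ≡⟨ ∑-distrib-+ {suc p} (d ∘ toℕ) (t ∘ toℕ) ⟨
    ∑[ k ≤ p ] (d (toℕ k) + t (toℕ k))
      ≡⟨ sum-cong-≗ {suc p} (λ k →
           solve 4 (λ s e h h′ → s :* (e :* (h :- h′)) :+ s :* (e :* h′) := s :* e :* h) refl
             (S (toℕ k)) (expˢ (p ∸ toℕ k)) H (harmonic (p ∸ toℕ k))) ⟩
    ∑[ k ≤ p ] (S (toℕ k) * expˢ (p ∸ toℕ k) * H)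
      ≡⟨ *-distribʳ-sum {suc p} H (λ k → S (toℕ k) * expˢ (p ∸ toℕ k)) ⟨
    ∑[ k ≤ p ] (S (toℕ k) * expˢ (p ∸ toℕ k)) * H
      ≡⟨ cong (_* H) (∑-stirling₂-expˢ p) ⟩
    w * e * H ∎

corollary5 : (p : ℕ) → p ≥ 1 →
    ∑[ i < p ] (let j = suc (toℕ i) in stirling₂ (p ℕ.+ 1) (p ∸ j) * (harmonic j /! j))
    ≡ (fromℕ (p !) - fromℕ ((p ℕ.+ 1) ℕ.* p ^ p) + fromℕ (p ^ (p ℕ.+ 1)) * harmonic p) /! p
corollary5 p _ rewrite ℕₚ.+-comm p 1 = ∑-stirling₂-harmonic p
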